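{- Let $1\le t\le n-1$, and let $S\subset\mathbb{F}_2^n$ be a linear code of block length $n$, dimension $d$ and minimal distance $t+1$. Let $\mathcal{B}_t=\{b_x : x\in\mathbb{F}_2^n\}$ be the $t$-th eigenconfiguration of the hypercube graph $H(n,2)$ and let $\pi$ be the coordinate projection of $\mathcal{B}_t$ onto the coordinates indexed by $y\in S$, $y\neq 0$. Then the convex hull of $\pi(\mathcal{B}_t)$ is a $(2^d-1)$-dimensional simplex with vertex set $\pi(\mathcal{B}_t)$. Moreover this produces a uniformly weighted design of $H(n,2)$ of strength $t$ with $2^{n-d}$ points which is the dual code of $S$: there is a vertex $p$ of this simplex such that $\{x\in\mathbb{F}_2^n : \pi(b_x)=p\}$ equals the dual code of $S$, and this set is a uniformly weighted design of strength $t$ with $2^{n-d}$ elements.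
   Context: The hypercube graph $H(n,2)$ has vertex set $\mathbb{F}_2^n$, with an edge between two vertices that differ in exactly one coordinate. For $y\in\mathbb{F}_2^n$, $|y|$ is the Hamming weight of $y$, and $\chi_y:\mathbb{F}_2^n\to\mathbb{R}$, $\chi_y(x)=(-1)^{y\cdot x}$, is an eigenvector of the Laplacian of $H(n,2)$ with eigenvalue $2|y|$. Hence the Laplacian eigenspaces, ordered by increasing eigenvalue, are $\Lambda_i=\operatorname{span}\{\chi_y:|y|=i\}$ for $i=0,\dots,n$, with $\dim\Lambda_i=\binom{n}{i}$. A subset $W\subset\mathbb{F}_2^n$ is a uniformly weighted design of strength $t$ if there is $a>0$ with $\frac{1}{2^n}\sum_{x\in\mathbb{F}_2^n}f(x)=a\sum_{w\in W}f(w)$ for all $f\in\Lambda_0\oplus\cdots\oplus\Lambda_t$. The $t$-th eigenconfiguration of $H(n,2)$ is the multiset of points $b_x=(\chi_y(x))_{y\in\mathbb{F}_2^n,\,|y|>t}$, $x\in\mathbb{F}_2^n$. A linear code with block length $n$ and minimal distance $t+1$ is a linear subspace $S\subset\mathbb{F}_2^n$ such that every nonzero $x\in S$ satisfies $|x|>t$; its dimension is its dimension as an $\mathbb{F}_2$-vector space. The dual code of $S$ is its orthogonal complement $\{x\in\mathbb{F}_2^n: x\cdot y=0 \text{ for all } y\in S\}$. -}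

module Defs where

open import Algebra.Apartness.Bundles using (HeytingField; HeytingCommutativeRing)
open import Algebra.Bundles using (CommutativeRing)
import Algebra.Apartness.Properties.HeytingCommutativeRing as HeytingProperties
import Algebra.Properties.Monoid.Sum as Sum
import Algebra.Properties.Ring as RingProperties
import Algebra.Properties.Semiring.Exp as Exp
import Algebra.Properties.Semiring.Mult as Mult
open import Data.Fin.Base using (Fin; zero; suc; toℕ)
open import Data.Nat.Base as ℕ using (ℕ; zero; suc; _≤_; _<_)
open import Data.Parity.Base as ℙ using (Parity; 0ℙ; 1ℙ)
import Data.Parity.Properties as ℙ
open import Data.Product.Base using (Σ-syntax; ∃-syntax; _×_; _,_; proj₁)
open import Data.Refinement.Base using (Refinement; Refinement-syntax; value; refine)
open import Data.Sum.Base using (_⊎_; inj₁; inj₂)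
open import Data.Vec.Base as Vec using (Vec; []; _∷_; _[_]%=_)
import Data.Vec.Functional as Vector
open Vector using (Vector)
open import Function.Base using (_∘_)
open import Function.Bundles using (_⇔_; Equivalence)
open import Function.Definitions using (Injective)
open import Level using (Level; _⊔_) renaming (suc to lsuc)
open import Relation.Binary.Core using (Rel)
open import Relation.Binary.PropositionalEquality.Core using (_≡_; _≢_)
import Relation.Binary.Reasoning.Setoid as SetoidReasoning
open import Relation.Binary.Structures using (IsStrictPartialOrder)
open import Relation.Nullary.Negation using (¬_)
open import Relation.Unary using (Pred; _∈_; _≐_)

private
  variable
    ℓ : Level
    n : ℕ

-- The standard library has no real numbers.  Everything below is carried
-- out over an arbitrary ordered field; the axioms hold for ℝ (classically,
-- and also for the constructive reals, whose order need not be decidable)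
-- and for ℚ.

record OrderedField c ℓ₁ ℓ₂ : Set (lsuc (c ⊔ ℓ₁ ⊔ ℓ₂)) where
  field
    heytingField : HeytingField c ℓ₁ ℓ₂

  open HeytingField heytingField public

  infix 4 _<ᶠ_ _≤ᶠ_

  field
    _<ᶠ_                 : Rel Carrier ℓ₂
    isStrictPartialOrder : IsStrictPartialOrder _≈_ _<ᶠ_
    #⇔<⊎>                : ∀ {x y} → x # y ⇔ (x <ᶠ y ⊎ y <ᶠ x)
    +-monoˡ-<            : ∀ {x y} z → x <ᶠ y → (x + z) <ᶠ (y + z)
    *-pos                : ∀ {x y} → 0# <ᶠ x → 0# <ᶠ y → 0# <ᶠ (x * y)

  _≤ᶠ_ : Rel Carrier ℓ₂
  x ≤ᶠ y = ¬ (y <ᶠ x)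

-- 𝔽₂ is the field of parities.

Word : ℕ → Set
Word n = Vec Parity n

𝟎 : Word n
𝟎 = Vec.replicate _ 0ℙ

infixl 6 _⊕_
_⊕_ : Word n → Word n → Word n
_⊕_ = Vec.zipWith ℙ._+_

infixr 7 _⊙_
_⊙_ : Parity → Word n → Word n
a ⊙ x = Vec.map (a ℙ.*_) x

infix 8 _∙_
_∙_ : Word n → Word n → Parity
x ∙ y = Vec.foldr′ ℙ._+_ 0ℙ (Vec.zipWith ℙ._*_ x y)

weight : Word n → ℕ
weight = Vec.count (ℙ._≟ 1ℙ)

combination₂ : ∀ {k} → Vector Parity k → Vector (Word n) k → Word n
combination₂ a b = Vector.foldr _⊕_ 𝟎 (λ i → a i ⊙ b i)

record IsSubspace {n} (S : Pred (Word n) ℓ) : Set ℓ where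
  field
    𝟎-closed : 𝟎 ∈ S
    ⊕-closed : ∀ {x y} → x ∈ S → y ∈ S → (x ⊕ y) ∈ S
    ⊙-closed : ∀ a {x} → x ∈ S → (a ⊙ x) ∈ S

record IsBasis {n k} (S : Pred (Word n) ℓ) (b : Vector (Word n) k) : Set ℓ where
  field
    members     : ∀ i → b i ∈ S
    independent : ∀ a → combination₂ a b ≡ 𝟎 → ∀ i → a i ≡ 0ℙ
    spanning    : ∀ x → x ∈ S → ∃[ a ] x ≡ combination₂ a b

HasDimension : Pred (Word n) ℓ → ℕ → Set ℓ
HasDimension S d = Σ[ b ∈ Vector (Word _) d ] IsBasis S b

-- As is usual for codes, "minimal distance δ" is a lower bound on the
-- nonzero weights; it is not required to be attained.

record IsLinearCode {n} (d δ : ℕ) (S : Pred (Word n) ℓ) : Set ℓ where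
  field
    isSubspace  : IsSubspace S
    dimension   : HasDimension S d
    minDistance : ∀ {x} → x ∈ S → x ≢ 𝟎 → δ ≤ weight x

Dual : Pred (Word n) ℓ → Pred (Word n) ℓ
Dual S x = ∀ y → y ∈ S → x ∙ y ≡ 0ℙ

Enumerates : ∀ {m} → Vector (Word n) m → Pred (Word n) ℓ → Set ℓ
Enumerates w W = Injective _≡_ _≡_ w × (∀ x → (x ∈ W) ⇔ (∃[ i ] w i ≡ x))

HasCardinality : Pred (Word n) ℓ → ℕ → Set ℓ
HasCardinality W m = Σ[ w ∈ Vector (Word _) m ] Enumerates w W

module OverOrderedField {c ℓ₁ ℓ₂} (F : OrderedField c ℓ₁ ℓ₂) where

  open OrderedField F
  open HeytingProperties heytingCommutativeRing using (1#0; x#0y#0→xy#0)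
  open CommutativeRing (HeytingCommutativeRing.commutativeRing heytingCommutativeRing)
    using (ring; semiring; +-monoid)
  open Sum +-monoid using (sum; sum-cong-≋)
  open Exp semiring using () renaming (_^_ to _^ᶠ_)
  open Mult semiring using () renaming (_×_ to _×ᶠ_)

  2# : Carrier
  2# = 1# + 1#

  2#0 : 2# # 0#
  2#0 = Equivalence.from #⇔<⊎> (sign (Equivalence.to #⇔<⊎> 1#0))
    where
    open IsStrictPartialOrder isStrictPartialOrder
      using (<-respˡ-≈; <-respʳ-≈) renaming (trans to <-trans)
    sign : 1# <ᶠ 0# ⊎ 0# <ᶠ 1# → 2# <ᶠ 0# ⊎ 0# <ᶠ 2#
    sign (inj₁ 1<0) = inj₁ (<-trans (<-respʳ-≈ (+-identityˡ 1#) (+-monoˡ-< 1# 1<0)) 1<0)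
    sign (inj₂ 0<1) = inj₂ (<-trans 0<1 (<-respˡ-≈ (+-identityˡ 1#) (+-monoˡ-< 1# 0<1)))

  2^n#0 : ∀ n → (2# ^ᶠ n) # 0#
  2^n#0 zero    = 1#0
  2^n#0 (suc n) = x#0y#0→xy#0 2#0 (2^n#0 n)

  infix 8 1/2^_
  1/2^_ : ℕ → Carrier
  1/2^ n = proj₁ (#⇒invertible (2^n#0 n))

  -- Points of the space F^I of families indexed by I; functions on 𝔽₂ⁿ
  -- are the points with I = Word n.

  Point : ∀ {i} → Set i → Set (c ⊔ i)
  Point I = I → Carrier

  private
    variable
      i ℓ′ : Level
      I    : Set i
      k    : ℕ

  infix 4 _≋_
  _≋_ : Rel (Point I) _
  p ≋ q = ∀ i → p i ≈ q i

  combination : Vector Carrier k → Vector (Point I) k → Point I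
  combination a v i = sum (λ j → a j * v j i)

  Image : ∀ {j} {J : Set j} → (J → Point I) → Pred (Point I) _
  Image f p = ∃[ j ] p ≋ f j

  Span : Pred (Point I) ℓ → Pred (Point I) _
  Span {I = I} V p =
    ∃[ k ] Σ[ v ∈ Vector (Point I) k ] Σ[ a ∈ Vector Carrier k ]
      (∀ j → v j ∈ V) × p ≋ combination a v

  ConvexHull : Pred (Point I) ℓ → Pred (Point I) _
  ConvexHull {I = I} V p =
    ∃[ k ] Σ[ v ∈ Vector (Point I) k ] Σ[ a ∈ Vector Carrier k ]
      (∀ j → v j ∈ V) × (∀ j → 0# ≤ᶠ a j) × sum a ≈ 1# × p ≋ combination a v

  AffinelyIndependent : Vector (Point I) k → Set _
  AffinelyIndependent v =
    ∀ a → sum a ≈ 0# → combination a v ≋ (λ _ → 0#) → ∀ j → a j ≈ 0#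

  -- C is the convex hull of k + 1 affinely independent points, and V is
  -- the set of these points.

  IsSimplex : ℕ → Pred (Point I) ℓ → Pred (Point I) ℓ′ → Set _
  IsSimplex {I = I} k V C =
    Σ[ v ∈ Vector (Point I) (suc k) ]
      AffinelyIndependent v × V ≐ Image v × C ≐ ConvexHull (Image v)

  infix 8 -1^_
  -1^_ : Parity → Carrier
  -1^ 0ℙ = 1#
  -1^ 1ℙ = - 1#

  χ : Word n → Point (Word n)
  χ y x = -1^ (y ∙ x)

  -- In H(n,2) the neighbours of x are the n words flip j x.

  flip : Fin n → Word n → Word n
  flip j x = x [ j ]%= ℙ._⁻¹

  laplacian : Point (Word n) → Point (Word n)
  laplacian f x = sum (λ j → f x - f (flip j x))

  -- By laplacian-χ below, Λ i consists of eigenvectors of the Laplacian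
  -- of H(n,2) for the eigenvalue 2i.  As the 2ⁿ characters χ y form a
  -- basis of the functions on 𝔽₂ⁿ, Λ 0, …, Λ n are all its eigenspaces,
  -- ordered by increasing eigenvalue.

  Λ : ℕ → Pred (Point (Word n)) (c ⊔ ℓ₁)
  Λ i = Span (λ f → ∃[ y ] weight y ≡ i × f ≋ χ y)

  -- The sum Λ 0 ⊕ ⋯ ⊕ Λ t; that it is direct is not part of membership.

  Λ≤ : ℕ → Pred (Point (Word n)) (c ⊔ ℓ₁)
  Λ≤ t f = Σ[ g ∈ Vector (Point (Word _)) (suc t) ]
    (∀ i → g i ∈ Λ (toℕ i)) × f ≋ (λ x → sum (λ i → g i x))

  private
    open RingProperties ring using (-‿involutive; -1*x≈-x; x[y-z]≈xy-xz)
    open SetoidReasoning setoid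

    -1^-⁻¹ : ∀ p → -1^ (p ℙ.⁻¹) ≈ - (-1^ p)
    -1^-⁻¹ 0ℙ = refl
    -1^-⁻¹ 1ℙ = sym (-‿involutive 1#)

    -1^-+ : ∀ p q → -1^ (p ℙ.+ q) ≈ (-1^ p) * (-1^ q)
    -1^-+ 0ℙ q = sym (*-identityˡ _)
    -1^-+ 1ℙ q = trans (-1^-⁻¹ q) (sym (-1*x≈-x _))

    sum-*ˡ : ∀ {k} a (f : Vector Carrier k) → sum (λ j → a * f j) ≈ a * sum f
    sum-*ˡ {zero}  a f = sym (zeroʳ a)
    sum-*ˡ {suc k} a f = trans (+-congˡ (sum-*ˡ a (f ∘ suc))) (sym (distribˡ a _ _))

    flipped : ∀ p q → -1^ (p ℙ.+ q) - -1^ (p ℙ.⁻¹ ℙ.+ q) ≈ 2# * -1^ (p ℙ.+ q)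
    flipped p q = begin
      -1^ (p ℙ.+ q) - -1^ (p ℙ.⁻¹ ℙ.+ q)          ≈⟨ +-congˡ (negated p) ⟩
      -1^ (p ℙ.+ q) + -1^ (p ℙ.+ q)               ≈⟨ +-cong (*-identityˡ _) (*-identityˡ _) ⟨
      1# * -1^ (p ℙ.+ q) + 1# * -1^ (p ℙ.+ q)     ≈⟨ distribʳ _ 1# 1# ⟨
      2# * -1^ (p ℙ.+ q)                          ∎
      where
      negated : ∀ p → - (-1^ (p ℙ.⁻¹ ℙ.+ q)) ≈ -1^ (p ℙ.+ q)
      negated 0ℙ = trans (-‿cong (-1^-⁻¹ q)) (-‿involutive _)
      negated 1ℙ = sym (-1^-⁻¹ q)

  laplacian-χ : (y : Word n) → laplacian (χ y) ≋ (λ x → (weight y ×ᶠ 2#) * χ y x)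
  laplacian-χ []       []       = sym (zeroˡ _)
  laplacian-χ (0ℙ ∷ y) (a ∷ x) = begin
    (χ y x - χ y x) + laplacian (χ y) x     ≈⟨ +-cong (-‿inverseʳ _) (laplacian-χ y x) ⟩
    0# + (weight y ×ᶠ 2#) * χ y x           ≈⟨ +-identityˡ _ ⟩
    (weight y ×ᶠ 2#) * χ y x                ∎
  laplacian-χ {suc n} (1ℙ ∷ y) (a ∷ x) = begin
    (z - -1^ (a ℙ.⁻¹ ℙ.+ y ∙ x)) + sum (λ j → z - -1^ (a ℙ.+ y ∙ flip j x))
      ≈⟨ +-cong (flipped a (y ∙ x)) (sum-cong-≋ {n} λ j →
           trans (+-cong (-1^-+ a (y ∙ x)) (-‿cong (-1^-+ a (y ∙ flip j x)))) (sym (x[y-z]≈xy-xz _ _ _))) ⟩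
    2# * z + sum (λ j → -1^ a * (χ y x - χ y (flip j x)))
      ≈⟨ +-congˡ (sum-*ˡ {n} (-1^ a) _) ⟩
    2# * z + -1^ a * laplacian (χ y) x
      ≈⟨ +-congˡ (*-congˡ (laplacian-χ y x)) ⟩
    2# * z + -1^ a * ((weight y ×ᶠ 2#) * χ y x)
      ≈⟨ +-congˡ (trans (sym (*-assoc _ _ _)) (trans (*-congʳ (*-comm _ _)) (*-assoc _ _ _))) ⟩
    2# * z + (weight y ×ᶠ 2#) * (-1^ a * χ y x)
      ≈⟨ +-congˡ (*-congˡ (-1^-+ a _)) ⟨
    2# * z + (weight y ×ᶠ 2#) * z
      ≈⟨ distribʳ z _ _ ⟨
    (suc (weight y) ×ᶠ 2#) * z ∎
    where z = χ (1ℙ ∷ y) (a ∷ x)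

  sumOverWords : ∀ n → Point (Word n) → Carrier
  sumOverWords zero    f = f []
  sumOverWords (suc n) f = sumOverWords n (f ∘ (0ℙ ∷_)) + sumOverWords n (f ∘ (1ℙ ∷_))

  IsUniformlyWeightedDesign : ℕ → Pred (Word n) ℓ → Set (c ⊔ ℓ₁ ⊔ ℓ₂ ⊔ ℓ)
  IsUniformlyWeightedDesign {n = n} t W =
    ∃[ m ] Σ[ w ∈ Vector (Word n) m ] Enumerates w W ×
    (∃[ a ] 0# <ᶠ a ×
      (∀ f → f ∈ Λ≤ t → 1/2^ n * sumOverWords n f ≈ a * sum (λ i → f (w i))))

  -- Refinement makes the membership proofs irrelevant, so the coordinates
  -- are indexed by words and not by words with proofs.

  HighWord : ℕ → ℕ → Set
  HighWord n t = [ y ∈ Word n ∣ t < weight y ]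

  NonzeroIn : Pred (Word n) ℓ → Set ℓ
  NonzeroIn S = [ y ∈ Word _ ∣ (y ∈ S × y ≢ 𝟎) ]

  -- The eigenconfiguration as a multiset: the family of its points b x.

  eigenconfiguration : ∀ n t → Word n → Point (HighWord n t)
  eigenconfiguration n t x y = χ (value y) x

  -- The nonzero words of a code of minimal distance t + 1 are among the
  -- coordinates of the t-th eigenconfiguration.

  project : ∀ {n d t} {S : Pred (Word n) ℓ} → IsLinearCode d (suc t) S →
            Point (HighWord n t) → Point (NonzeroIn S)
  project code p = p ∘ refine λ (y∈S , y≢𝟎) → minDistance y∈S y≢𝟎
    where open IsLinearCode code

{-# OPTIONS --safe #-}
module Submission where

-- Let b be a basis of S and let the syndrome of x be the word (bᵢ · x)ᵢ of 𝔽₂ᵈ.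
-- Expanding the indicator of a syndrome fibre in the characters of 𝔽₂ᵈ writes
-- 2ᵈ times a sum over the fibre as Σ_{y ∈ S} ± Σ_x χ_y(x) f(x).  If f is orthogonal
-- to χ_y for all nonzero y ∈ S, only y = 0 remains.  Taking f = 1 shows
-- that every syndrome occurs exactly 2ⁿ⁻ᵈ times; taking f in Λ 0 ⊕ ⋯ ⊕ Λ t, where
-- orthogonality holds because |y| > t, shows that the fibre over 0, the dual code, is a
-- design.  The projection π (b x) depends only on the syndrome of x, and its
-- coordinates are the nontrivial characters of the syndrome, so Fourier
-- inversion on 𝔽₂ᵈ makes the 2ᵈ points of the image affinely independent.

open import Defs
open import Algebra.Bundles using (CommutativeRing)
open import Algebra.Apartness.Bundles using (HeytingCommutativeRing)
import Algebra.Apartness.Properties.HeytingCommutativeRing as HeytingProperties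
import Algebra.Properties.CommutativeSemigroup as CommutativeSemigroupProperties
import Algebra.Properties.Monoid.Mult as MonoidMult
import Algebra.Properties.Ring as RingProperties
import Algebra.Properties.Semiring.Exp as Exp
import Algebra.Properties.Semiring.Mult as Mult
import Algebra.Properties.Semiring.Sum as Sum
open import Data.Fin.Base as Fin using (Fin; zero; suc; toℕ; splitAt; _↑ˡ_; _↑ʳ_)
import Data.Fin.Properties as Fin
open import Data.Irrelevant using ([_])
open import Data.Nat.Base as ℕ using (ℕ; zero; suc; _≤_; _<_; _∸_; _^_; z≤n; s≤s)
import Data.Nat.Properties as ℕ
open import Data.Parity.Base as ℙ using (Parity; 0ℙ; 1ℙ)
import Data.Parity.Properties as ℙ
open import Data.Product.Base using (_×_; _,_; ∃-syntax; proj₁; proj₂)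
open import Data.Refinement.Base using (_,_)
open import Data.Sum.Base as ⊎ using (_⊎_; inj₁; inj₂; [_,_]′)
open import Data.Unit.Base using (tt)
open import Data.Vec.Base as Vec using ([]; _∷_)
import Data.Vec.Properties as Vec
open import Data.Vec.Functional using (Vector)
open import Function.Base using (_∘_)
open import Function.Bundles using (Equivalence; mk⇔)
open import Function.Definitions using (Injective)
open import Level using (Level; _⊔_)
open import Relation.Binary.Definitions using (DecidableEquality; tri<; tri≈; tri>)
open import Relation.Binary.PropositionalEquality as ≡ using (_≡_; _≢_; cong; cong₂; subst)
import Relation.Binary.Reasoning.Setoid as SetoidReasoning
open import Relation.Binary.Structures using (IsStrictPartialOrder)
open import Relation.Nullary using (Dec; yes; no; contradiction; recompute)
open import Relation.Unary using (Pred; Decidable; _∈_; _≐_)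
open import Relation.Unary.Properties using (U?)

private
  variable
    ℓ ℓ′ : Level
    n d : ℕ

-- The dot product on 𝔽₂ⁿ.

infix 4 _≟_
_≟_ : DecidableEquality (Word n)
_≟_ = Vec.≡-dec ℙ._≟_

∙-comm : (x y : Word n) → x ∙ y ≡ y ∙ x
∙-comm []      []      = ≡.refl
∙-comm (a ∷ x) (b ∷ y) = cong₂ ℙ._+_ (ℙ.*-comm a b) (∙-comm x y)

∙-zeroˡ : (x : Word n) → 𝟎 ∙ x ≡ 0ℙ
∙-zeroˡ []      = ≡.refl
∙-zeroˡ (_ ∷ x) = ∙-zeroˡ x

∙-zeroʳ : (x : Word n) → x ∙ 𝟎 ≡ 0ℙ
∙-zeroʳ x = ≡.trans (∙-comm x 𝟎) (∙-zeroˡ x)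

∙-⊙ : ∀ a (x y : Word n) → (a ⊙ x) ∙ y ≡ a ℙ.* (x ∙ y)
∙-⊙ 0ℙ []      []      = ≡.refl
∙-⊙ 0ℙ (_ ∷ x) (_ ∷ y) = ∙-⊙ 0ℙ x y
∙-⊙ 1ℙ x       y       = cong (_∙ y) (Vec.map-id x)

∙-⊕ : (x y z : Word n) → (x ⊕ y) ∙ z ≡ x ∙ z ℙ.+ y ∙ z
∙-⊕ []      []      []      = ≡.refl
∙-⊕ (a ∷ x) (b ∷ y) (c ∷ z) =
  ≡.trans (cong₂ ℙ._+_ (ℙ.*-distribʳ-+ c a b) (∙-⊕ x y z))
          (interchange (a ℙ.* c) (b ℙ.* c) (x ∙ z) (y ∙ z))
  where open CommutativeSemigroupProperties ℙ.+-commutativeSemigroup using (interchange)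

⊕≡𝟎⇒≡ : (x y : Word n) → x ⊕ y ≡ 𝟎 → x ≡ y
⊕≡𝟎⇒≡ []      []      _  = ≡.refl
⊕≡𝟎⇒≡ (a ∷ x) (b ∷ y) eq =
  cong₂ _∷_ (ℙ.+-cancelʳ-≡ b a b (≡.trans (Vec.∷-injectiveˡ eq) (≡.sym (ℙ.p+p≡0ℙ b))))
            (⊕≡𝟎⇒≡ x y (Vec.∷-injectiveʳ eq))

-- Encoding and syndrome with respect to a basis of the code.

encode : Vector (Word n) d → Word d → Word n
encode b c = combination₂ (Vec.lookup c) b

-- The `b i` act as parity checks: the words of syndrome zero form the dual of their span.
syndrome : Vector (Word n) d → Word n → Word d
syndrome b x = Vec.tabulate (λ i → b i ∙ x)

-- With the `b i` as the rows of a matrix B, `encode` is c ↦ cB and `syndrome` is x ↦ Bx, so the two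
-- maps are transposes of each other.
encode-∙ : (b : Vector (Word n) d) (c : Word d) (x : Word n) →
           encode b c ∙ x ≡ c ∙ syndrome b x
encode-∙ b []      x = ∙-zeroˡ x
encode-∙ b (a ∷ c) x =
  ≡.trans (∙-⊕ (a ⊙ b zero) (encode (b ∘ suc) c) x)
          (cong₂ ℙ._+_ (∙-⊙ a (b zero) x) (encode-∙ (b ∘ suc) c x))

combination₂-cong : ∀ {k} {a a′ : Vector Parity k} (b : Vector (Word n) k) →
                    (∀ i → a i ≡ a′ i) → combination₂ a b ≡ combination₂ a′ b
combination₂-cong {k = zero}  b eq = ≡.refl
combination₂-cong {k = suc k} b eq =
  cong₂ _⊕_ (cong (_⊙ b zero) (eq zero)) (combination₂-cong (b ∘ suc) (eq ∘ suc))

lookup-𝟎 : (c : Word d) → (∀ i → Vec.lookup c i ≡ 0ℙ) → c ≡ 𝟎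
lookup-𝟎 []      eq = ≡.refl
lookup-𝟎 (a ∷ c) eq = cong₂ _∷_ (eq zero) (lookup-𝟎 c (eq ∘ suc))

module _ {S : Pred (Word n) ℓ} {b : Vector (Word n) d} (basis : IsBasis S b) where
  open IsBasis basis

  encode-surjective : ∀ y → y ∈ S → ∃[ c ] encode b c ≡ y
  encode-surjective y y∈S with a , eq ← spanning y y∈S =
    Vec.tabulate a ,
    ≡.trans (combination₂-cong b (Vec.lookup∘tabulate a)) (≡.sym eq)

  encode-nonzero : ∀ c → c ≢ 𝟎 → encode b c ≢ 𝟎
  encode-nonzero c c≢𝟎 eq = c≢𝟎 (lookup-𝟎 c (independent (Vec.lookup c) eq))

encode-∈ : {S : Pred (Word n) ℓ} → IsSubspace S → (b : Vector (Word n) d) →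
           (∀ i → b i ∈ S) → ∀ c → encode b c ∈ S
encode-∈ sub b b∈ []      = IsSubspace.𝟎-closed sub
encode-∈ sub b b∈ (a ∷ c) =
  IsSubspace.⊕-closed sub (IsSubspace.⊙-closed sub a (b∈ zero))
                          (encode-∈ sub (b ∘ suc) (b∈ ∘ suc) c)

-- Every codeword is some `encode b c`, and its product with `x` is `c ∙ syndrome b x`.
syndrome-≡⇒∙-≡ : {S : Pred (Word n) ℓ} {b : Vector (Word n) d} → IsBasis S b →
                 ∀ {x x′} → syndrome b x ≡ syndrome b x′ →
                 ∀ y → y ∈ S → y ∙ x ≡ y ∙ x′
syndrome-≡⇒∙-≡ {b = b} basis {x} {x′} eq y y∈S
  with c , ≡.refl ← encode-surjective basis y y∈S =
  ≡.trans (encode-∙ b c x) (≡.trans (cong (c ∙_) eq) (≡.sym (encode-∙ b c x′)))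

-- Positivity of 2ⁿ rules out `m` = 0, and a positive `m` forces d ≤ n, so the truncated subtraction
-- is a true difference.
2^d*m≡2^n⇒m≡2^[n∸d] : ∀ d n m → 2 ^ d ℕ.* m ≡ 2 ^ n → m ≡ 2 ^ (n ∸ d)
2^d*m≡2^n⇒m≡2^[n∸d] d n zero eq =
  contradiction (≡.trans (≡.sym eq) (ℕ.*-zeroʳ (2 ^ d))) (ℕ.≢-nonZero⁻¹ (2 ^ n) {{ℕ.m^n≢0 2 n}})
2^d*m≡2^n⇒m≡2^[n∸d] d n m@(suc _) eq with d ℕ.≤? n
... | yes d≤n = ℕ.*-cancelˡ-≡ m (2 ^ (n ∸ d)) (2 ^ d) {{ℕ.m^n≢0 2 d}}
      (≡.trans eq (≡.trans (cong (2 ^_) (≡.sym (ℕ.m+[n∸m]≡n d≤n)))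
                           (ℕ.^-distribˡ-+-* 2 d (n ∸ d))))
... | no d≰n = contradiction
      (ℕ.≤-trans (ℕ.m≤m*n (2 ^ d) m) (ℕ.≤-reflexive eq))
      (ℕ.<⇒≱ (ℕ.^-monoʳ-< 2 (s≤s (s≤s z≤n)) (ℕ.≰⇒> d≰n)))

module _ {c ℓ₁ ℓ₂} (F : OrderedField c ℓ₁ ℓ₂) where
  open OrderedField F hiding (zero)
  open OverOrderedField F
  open HeytingProperties heytingCommutativeRing using (1#0; x-0≈x; invertibleˡ⇒#)
  open CommutativeRing (HeytingCommutativeRing.commutativeRing heytingCommutativeRing)
    using (ring; semiring; +-monoid; *-commutativeSemigroup; +-commutativeSemigroup)
  open Sum semiring
    using (sum; sum-cong-≋; sum-replicate; sum-replicate-zero; ∑-distrib-+; *-distribˡ-sum)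
  open Exp semiring using () renaming (_^_ to _^ᶠ_)
  open Mult semiring using (×1-homo-*) renaming (_×_ to _×ᶠ_)
  open MonoidMult +-monoid using (×-homo-+; ×-congˡ)
  open RingProperties ring using (-‿involutive; -1*x≈-x; -‿distribˡ-*; -‿distribʳ-*)
  open CommutativeSemigroupProperties *-commutativeSemigroup
    using (x∙yz≈y∙xz)
  open CommutativeSemigroupProperties +-commutativeSemigroup using ()
    renaming (interchange to +-interchange)
  open SetoidReasoning setoid
  open IsStrictPartialOrder isStrictPartialOrder
    using (<-respˡ-≈; <-respʳ-≈) renaming (trans to <-trans; irrefl to <-irrefl)

  -- Positivity and natural numbers in the ordered field.

  ι : ℕ → Carrier
  ι n = n ×ᶠ 1#

  x#0⇒0<x² : ∀ {x} → x # 0# → 0# <ᶠ x * x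
  x#0⇒0<x² {x} x#0 with Equivalence.to #⇔<⊎> x#0
  ... | inj₂ 0<x = *-pos 0<x 0<x
  ... | inj₁ x<0 = <-respʳ-≈ [-x][-x]≈xx (*-pos 0<-x 0<-x)
    where
    [-x][-x]≈xx : - x * - x ≈ x * x
    [-x][-x]≈xx = trans (sym (-‿distribˡ-* x (- x)))
      (trans (-‿cong (sym (-‿distribʳ-* x x))) (-‿involutive (x * x)))
    0<-x : 0# <ᶠ - x
    0<-x = <-respˡ-≈ (-‿inverseʳ x) (<-respʳ-≈ (+-identityˡ _) (+-monoˡ-< (- x) x<0))

  0<1 : 0# <ᶠ 1#
  0<1 = <-respʳ-≈ (*-identityˡ 1#) (x#0⇒0<x² 1#0)

  0<⇒#0 : ∀ {x} → 0# <ᶠ x → x # 0#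
  0<⇒#0 0<x = Equivalence.from #⇔<⊎> (inj₂ 0<x)

  x<1+x : ∀ x → x <ᶠ 1# + x
  x<1+x x = <-respˡ-≈ (+-identityˡ x) (+-monoˡ-< x 0<1)

  0<2 : 0# <ᶠ 2#
  0<2 = <-trans 0<1 (x<1+x 1#)

  ^-pos : ∀ {x} n → 0# <ᶠ x → 0# <ᶠ x ^ᶠ n
  ^-pos zero    0<x = 0<1
  ^-pos (suc n) 0<x = *-pos 0<x (^-pos n 0<x)

  -- `1/2^ n` is given only as a witness of invertibility, so its sign is read off from u = u²v,
  -- where u² and v = 2ⁿ are both positive.
  0<1/2^ : ∀ n → 0# <ᶠ 1/2^ n
  0<1/2^ n = <-respʳ-≈ u²v≈u (*-pos (x#0⇒0<x² u#0) (^-pos n 0<2))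
    where
    u = 1/2^ n
    v = 2# ^ᶠ n
    uv≈1 : u * v ≈ 1#
    -- `#⇒invertible` inverts the difference `v - 0#`, not `v` itself.
    uv≈1 = trans (*-congˡ (sym (x-0≈x v))) (proj₁ (proj₂ (#⇒invertible (2^n#0 n))))
    u#0 : u # 0#
    u#0 = invertibleˡ⇒# (v , trans (*-congˡ (x-0≈x u)) (trans (*-comm v u) uv≈1))
    u²v≈u : u * u * v ≈ u
    u²v≈u = trans (*-assoc u u v) (trans (*-congˡ uv≈1) (*-identityʳ u))

  *-cancelˡ-#0 : ∀ {x y} → x # 0# → x * y ≈ 0# → y ≈ 0#
  *-cancelˡ-#0 {x} {y} x#0 xy≈0 with u , ux≈1 , _ ← #⇒invertible x#0 = begin
    y                     ≈⟨ *-identityˡ y ⟨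
    1# * y                ≈⟨ *-congʳ ux≈1 ⟨
    u * (x - 0#) * y      ≈⟨ *-congʳ (*-congˡ (x-0≈x x)) ⟩
    u * x * y             ≈⟨ *-assoc u x y ⟩
    u * (x * y)           ≈⟨ *-congˡ xy≈0 ⟩
    u * 0#                ≈⟨ zeroʳ u ⟩
    0#                    ∎

  ι-mono-< : ∀ {m n} → m ℕ.<′ n → ι m <ᶠ ι n
  ι-mono-< ℕ.≤′-refl       = x<1+x _
  ι-mono-< (ℕ.≤′-step m<n) = <-trans (ι-mono-< m<n) (x<1+x _)

  -- An ordered field has characteristic zero. This turns cardinalities computed in the field into
  -- equations between natural numbers.
  ι-injective : ∀ m n → ι m ≈ ι n → m ≡ n
  ι-injective m n eq with ℕ.<-cmp m n
  ... | tri< m<n _ _ = contradiction (ι-mono-< (ℕ.<⇒<′ m<n)) (<-irrefl eq)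
  ... | tri≈ _ m≡n _ = m≡n
  ... | tri> _ _ n<m = contradiction (ι-mono-< (ℕ.<⇒<′ n<m)) (<-irrefl (sym eq))

  0<ι2^ : ∀ n → 0# <ᶠ ι (2 ^ n)
  0<ι2^ n = ι-mono-< (ℕ.<⇒<′ (ℕ.m^n>0 2 n))

  -- Finite sums and sums over all words.

  sum-zero : ∀ {k} {g : Vector Carrier k} → (∀ i → g i ≈ 0#) → sum g ≈ 0#
  sum-zero {k} g≈0 = trans (sum-cong-≋ g≈0) (sum-replicate-zero k)

  sum-unique : ∀ {k} {g : Vector Carrier k} j → (∀ i → i ≢ j → g i ≈ 0#) → sum g ≈ g j
  sum-unique zero    g≈0 =
    trans (+-congˡ (sum-zero λ i → g≈0 (suc i) λ ())) (+-identityʳ _)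
  sum-unique (suc j) g≈0 =
    trans (+-cong (g≈0 zero λ ()) (sum-unique j λ i i≢j → g≈0 (suc i) (i≢j ∘ Fin.suc-injective)))
          (+-identityˡ _)

  sum-splitAt : ∀ m {k} (h : Fin m ⊎ Fin k → Carrier) →
                sum (h ∘ splitAt m) ≈ sum (h ∘ inj₁) + sum (h ∘ inj₂)
  sum-splitAt zero    h = sym (+-identityˡ _)
  sum-splitAt (suc m) h =
    trans (+-congˡ (sum-splitAt m (h ∘ ⊎.map₁ suc))) (sym (+-assoc _ _ _))

  sumOverWords-cong : ∀ n {f g : Point (Word n)} → f ≋ g → sumOverWords n f ≈ sumOverWords n g
  sumOverWords-cong zero    f≋g = f≋g []
  sumOverWords-cong (suc n) f≋g =
    +-cong (sumOverWords-cong n (f≋g ∘ (0ℙ ∷_))) (sumOverWords-cong n (f≋g ∘ (1ℙ ∷_)))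

  sumOverWords-+ : ∀ n (f g : Point (Word n)) →
                   sumOverWords n (λ x → f x + g x) ≈ sumOverWords n f + sumOverWords n g
  sumOverWords-+ zero    f g = refl
  sumOverWords-+ (suc n) f g =
    trans (+-cong (sumOverWords-+ n _ _) (sumOverWords-+ n _ _)) (+-interchange _ _ _ _)

  sumOverWords-*ˡ : ∀ n a (f : Point (Word n)) →
                    sumOverWords n (λ x → a * f x) ≈ a * sumOverWords n f
  sumOverWords-*ˡ zero    a f = refl
  sumOverWords-*ˡ (suc n) a f =
    trans (+-cong (sumOverWords-*ˡ n a _) (sumOverWords-*ˡ n a _)) (sym (distribˡ a _ _))

  sumOverWords-zero : ∀ n {f : Point (Word n)} → (∀ x → f x ≈ 0#) → sumOverWords n f ≈ 0#
  sumOverWords-zero zero    f≈0 = f≈0 []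
  sumOverWords-zero (suc n) f≈0 =
    trans (+-cong (sumOverWords-zero n (f≈0 ∘ (0ℙ ∷_))) (sumOverWords-zero n (f≈0 ∘ (1ℙ ∷_))))
          (+-identityʳ 0#)

  sumOverWords-unique : ∀ n {f : Point (Word n)} → (∀ x → x ≢ 𝟎 → f x ≈ 0#) →
                        sumOverWords n f ≈ f 𝟎
  sumOverWords-unique zero    f≈0 = refl
  sumOverWords-unique (suc n) f≈0 =
    trans (+-cong (sumOverWords-unique n λ x x≢𝟎 → f≈0 (0ℙ ∷ x) (x≢𝟎 ∘ Vec.∷-injectiveʳ))
                  (sumOverWords-zero n λ x → f≈0 (1ℙ ∷ x) λ ()))
          (+-identityʳ _)

  sumOverWords-1 : ∀ n → sumOverWords n (λ _ → 1#) ≈ ι (2 ^ n)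
  sumOverWords-1 zero    = sym (+-identityʳ 1#)
  sumOverWords-1 (suc n) = begin
    sumOverWords n _ + sumOverWords n _  ≈⟨ +-cong (sumOverWords-1 n) (sumOverWords-1 n) ⟩
    ι (2 ^ n) + ι (2 ^ n)                ≈⟨ ×-homo-+ 1# (2 ^ n) (2 ^ n) ⟨
    ι (2 ^ n ℕ.+ 2 ^ n)                  ≈⟨ ×-congˡ (cong (2 ^ n ℕ.+_) (≡.sym (ℕ.+-identityʳ (2 ^ n)))) ⟩
    ι (2 ^ suc n)                        ∎

  sumOverWords-sum : ∀ n {k} (h : Word n → Vector Carrier k) →
                     sumOverWords n (λ x → sum (h x)) ≈ sum (λ j → sumOverWords n (λ x → h x j))
  sumOverWords-sum zero    h = refl
  sumOverWords-sum (suc n) h =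
    trans (+-cong (sumOverWords-sum n (h ∘ (0ℙ ∷_))) (sumOverWords-sum n (h ∘ (1ℙ ∷_))))
          (sym (∑-distrib-+ (λ j → sumOverWords n (λ x → h (0ℙ ∷ x) j)) _))

  sumOverWords-swap : ∀ n d (h : Word n → Word d → Carrier) →
                      sumOverWords n (λ x → sumOverWords d (h x)) ≈
                      sumOverWords d (λ c → sumOverWords n (λ x → h x c))
  sumOverWords-swap zero    d h = refl
  sumOverWords-swap (suc n) d h =
    trans (+-cong (sumOverWords-swap n d _) (sumOverWords-swap n d _))
          (sym (sumOverWords-+ d _ _))

  -- Characters and their orthogonality.

  -1^-+ : ∀ p q → -1^ (p ℙ.+ q) ≈ (-1^ p) * (-1^ q)
  -1^-+ 0ℙ q  = sym (*-identityˡ _)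
  -1^-+ 1ℙ 0ℙ = sym (*-identityʳ _)
  -1^-+ 1ℙ 1ℙ = sym (trans (-1*x≈-x _) (-‿involutive 1#))

  -- If 1 ≈ -1 then 2 ≈ 0, against `2#0`. This allows parities to be read back from coordinates in
  -- the field.
  -1^-injective : ∀ p q → -1^ p ≈ -1^ q → p ≡ q
  -1^-injective 0ℙ 0ℙ eq = ≡.refl
  -1^-injective 0ℙ 1ℙ eq =
    contradiction 2#0 (#-irrefl (trans (+-congˡ eq) (-‿inverseʳ 1#)))
  -1^-injective 1ℙ 0ℙ eq =
    contradiction 2#0 (#-irrefl (trans (+-congˡ (sym eq)) (-‿inverseʳ 1#)))
  -1^-injective 1ℙ 1ℙ eq = ≡.refl

  χ-⊕ : (y z x : Word n) → χ (y ⊕ z) x ≈ χ y x * χ z x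
  χ-⊕ y z x = trans (reflexive (cong -1^_ (∙-⊕ y z x))) (-1^-+ (y ∙ x) (z ∙ x))

  χ-comm : (y x : Word n) → χ y x ≈ χ x y
  χ-comm y x = reflexive (cong -1^_ (∙-comm y x))

  χ-𝟎 : (x : Word n) → χ 𝟎 x ≈ 1#
  χ-𝟎 x = reflexive (cong -1^_ (∙-zeroˡ x))

  χ² : (y x : Word n) → χ y x * χ y x ≈ 1#
  χ² y x = trans (sym (-1^-+ (y ∙ x) (y ∙ x))) (reflexive (cong -1^_ (ℙ.p+p≡0ℙ (y ∙ x))))

  -- The sum splits by the first letter of the argument. If `y` begins with 1 the two halves cancel;
  -- if it begins with 0 both vanish by induction.
  sumOverWords-χ : (y : Word n) → y ≢ 𝟎 → sumOverWords n (χ y) ≈ 0#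
  sumOverWords-χ []       y≢𝟎 = contradiction ≡.refl y≢𝟎
  sumOverWords-χ (0ℙ ∷ y) y≢𝟎 = trans (+-cong Σχ≈0 Σχ≈0) (+-identityʳ 0#)
    where Σχ≈0 = sumOverWords-χ y (y≢𝟎 ∘ cong (0ℙ ∷_))
  sumOverWords-χ {n = suc n} (1ℙ ∷ y) y≢𝟎 = begin
    sumOverWords n (χ y) + sumOverWords n (λ x → -1^ (1ℙ ℙ.+ y ∙ x))
      ≈⟨ +-congˡ (sumOverWords-cong n λ x → -1^-+ 1ℙ (y ∙ x)) ⟩
    sumOverWords n (χ y) + sumOverWords n (λ x → - 1# * χ y x)
      ≈⟨ +-congˡ (trans (sumOverWords-*ˡ n (- 1#) (χ y)) (-1*x≈-x _)) ⟩
    sumOverWords n (χ y) - sumOverWords n (χ y)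
      ≈⟨ -‿inverseʳ _ ⟩
    0# ∎

  -- The product of the two characters is the character of `y ⊕ z`, which is nontrivial.
  χ-orthogonal : (y z : Word n) → y ≢ z → sumOverWords n (λ x → χ y x * χ z x) ≈ 0#
  χ-orthogonal {n = n} y z y≢z =
    trans (sumOverWords-cong n λ x → sym (χ-⊕ y z x))
          (sumOverWords-χ (y ⊕ z) (y≢z ∘ ⊕≡𝟎⇒≡ y z))

  indicator : ∀ {a} {A : Set a} → Dec A → Carrier
  indicator (yes _) = 1#
  indicator (no _)  = 0#

  -- The symmetry of `χ` in its two arguments reduces this to the relation between distinct
  -- characters. Read as a function of `u`, it expands the indicator of `s` in characters.
  χ-column-orthogonal : (s u : Word n) →
    sumOverWords n (λ y → χ y s * χ y u) ≈ ι (2 ^ n) * indicator (u ≟ s)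
  χ-column-orthogonal {n = n} s u with u ≟ s
  ... | yes ≡.refl =
    trans (trans (sumOverWords-cong n λ y → χ² y s) (sumOverWords-1 n)) (sym (*-identityʳ _))
  ... | no u≢s =
    trans (trans (sumOverWords-cong n λ y → *-cong (χ-comm y s) (χ-comm y u))
                 (χ-orthogonal s u (u≢s ∘ ≡.sym)))
          (sym (zeroʳ _))

  -- Enumerations of decidable sets of words.

  record Listing {P : Pred (Word n) ℓ} (P? : Decidable P) (m : ℕ) : Set (c ⊔ ℓ₁ ⊔ ℓ) where
    field
      word       : Vector (Word n) m
      enumerates : Enumerates word P
      sum-word   : ∀ f → sum (f ∘ word) ≈ sumOverWords n (λ x → indicator (P? x) * f x)

  open Listing

  -- The listings for the two possible first letters are concatenated, matching the recursion of
  -- `sumOverWords`.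
  listing : {P : Pred (Word n) ℓ} (P? : Decidable P) → ∃[ m ] Listing P? m
  listing {n = zero} {P = P} P? with P? [] in eq
  ... | yes p = 1 , record
    { word       = λ _ → []
    ; enumerates = (λ { {zero} {zero} _ → ≡.refl }) , λ { [] → mk⇔ (λ _ → zero , ≡.refl) (λ _ → p) }
    ; sum-word   = λ f → trans (+-identityʳ _)
        (trans (sym (*-identityˡ _)) (*-congʳ (reflexive (cong indicator (≡.sym eq)))))
    }
  ... | no ¬p = 0 , record
    { word       = λ ()
    ; enumerates = (λ { {()} }) , λ { [] → mk⇔ (λ p → contradiction p ¬p) λ () }
    ; sum-word   = λ f → trans (sym (zeroˡ _)) (*-congʳ (reflexive (cong indicator (≡.sym eq))))
    }
  listing {n = suc n} {P = P} P?
    with m₀ , L₀ ← listing (P? ∘ (0ℙ ∷_)) | m₁ , L₁ ← listing (P? ∘ (1ℙ ∷_))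
    = m₀ ℕ.+ m₁ , record
    { word       = glued ∘ splitAt m₀
    ; enumerates = injective , λ x → mk⇔ (to x) (λ { (i , ≡.refl) → from (splitAt m₀ i) })
    ; sum-word   = λ f → trans (sum-splitAt m₀ (f ∘ glued)) (+-cong (sum-word L₀ _) (sum-word L₁ _))
    }
    where
    glued : Fin m₀ ⊎ Fin m₁ → Word (suc n)
    glued = [ (0ℙ ∷_) ∘ word L₀ , (1ℙ ∷_) ∘ word L₁ ]′

    glued-injective : ∀ i j → glued i ≡ glued j → i ≡ j
    glued-injective (inj₁ i) (inj₁ j) eq = cong inj₁ (proj₁ (enumerates L₀) (Vec.∷-injectiveʳ eq))
    glued-injective (inj₂ i) (inj₂ j) eq = cong inj₂ (proj₁ (enumerates L₁) (Vec.∷-injectiveʳ eq))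
    glued-injective (inj₁ i) (inj₂ j) ()
    glued-injective (inj₂ i) (inj₁ j) ()

    injective : Injective _≡_ _≡_ (glued ∘ splitAt m₀)
    injective {i} {j} eq =
      ≡.trans (≡.sym (Fin.join-splitAt m₀ m₁ i))
        (≡.trans (cong (Fin.join m₀ m₁) (glued-injective (splitAt m₀ i) (splitAt m₀ j) eq))
                 (Fin.join-splitAt m₀ m₁ j))

    to : ∀ x → x ∈ P → ∃[ i ] glued (splitAt m₀ i) ≡ x
    to (0ℙ ∷ x) x∈P with i , ≡.refl ← Equivalence.to (proj₂ (enumerates L₀) x) x∈P =
      i ↑ˡ m₁ , cong glued (Fin.splitAt-↑ˡ m₀ i m₁)
    to (1ℙ ∷ x) x∈P with i , ≡.refl ← Equivalence.to (proj₂ (enumerates L₁) x) x∈P =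
      m₀ ↑ʳ i , cong glued (Fin.splitAt-↑ʳ m₀ m₁ i)

    from : ∀ i → glued i ∈ P
    from (inj₁ i) = Equivalence.from (proj₂ (enumerates L₀) _) (i , ≡.refl)
    from (inj₂ i) = Equivalence.from (proj₂ (enumerates L₁) _) (i , ≡.refl)

  -- `sum-word` at the constant function 1 counts the words inside the field, and injectivity of `ι`
  -- then fixes the length.
  allWords : ∀ n → Listing {n} U? (2 ^ n)
  allWords n with m , L ← listing {n} U? =
    subst (Listing _) (ι-injective m (2 ^ n) ιm≈ι2^n) L
    where
    ιm≈ι2^n : ι m ≈ ι (2 ^ n)
    ιm≈ι2^n = begin
      ι m                             ≈⟨ sum-replicate m ⟨
      sum {m} (λ _ → 1#)              ≈⟨ sum-word L (λ _ → 1#) ⟩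
      sumOverWords n (λ _ → 1# * 1#)  ≈⟨ sumOverWords-cong n (λ _ → *-identityˡ 1#) ⟩
      sumOverWords n (λ _ → 1#)       ≈⟨ sumOverWords-1 n ⟩
      ι (2 ^ n)                       ∎

  -- Functions in Λ 0 ⊕ ⋯ ⊕ Λ t and sums over syndrome fibres.

  orthogonal-combination : ∀ {k n} (h p : Point (Word n))
    {a : Vector Carrier k} {v : Vector (Point (Word n)) k} →
    (∀ j → sumOverWords n (λ x → h x * v j x) ≈ 0#) → p ≋ combination a v →
    sumOverWords n (λ x → h x * p x) ≈ 0#
  orthogonal-combination {n = n} h p {a} {v} orth p≋ = begin
    sumOverWords n (λ x → h x * p x)
      ≈⟨ sumOverWords-cong n (λ x → trans (*-congˡ (p≋ x)) (trans
           (*-distribˡ-sum (h x) (λ j → a j * v j x))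
           (sum-cong-≋ λ j → x∙yz≈y∙xz (h x) (a j) (v j x)))) ⟩
    sumOverWords n (λ x → sum (λ j → a j * (h x * v j x)))
      ≈⟨ sumOverWords-sum n (λ x j → a j * (h x * v j x)) ⟩
    sum (λ j → sumOverWords n (λ x → a j * (h x * v j x)))
      ≈⟨ sum-zero (λ j → trans (sumOverWords-*ˡ n (a j) _) (trans (*-congˡ (orth j)) (zeroʳ (a j)))) ⟩
    0# ∎

  -- Every generator is a character `χ y` with |y| ≤ t < |z|, hence y ≠ z and the two characters are
  -- orthogonal.
  χ-orthogonal-Λ≤ : ∀ {t} (z : Word n) → t < weight z → ∀ f → f ∈ Λ≤ t →
                    sumOverWords n (λ x → χ z x * f x) ≈ 0#
  χ-orthogonal-Λ≤ {n = n} {t} z t<z f (g , g∈Λ , f≋) =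
    -- Unit coefficients present the sum of the components `g i` as a linear combination, so one
    -- linearity lemma serves for this sum and for each span.
    orthogonal-combination (χ z) f {a = λ _ → 1#} {v = g} (λ i → orth i (g∈Λ i))
      (λ x → trans (f≋ x) (sum-cong-≋ λ i → sym (*-identityˡ (g i x))))
    where
    orth : ∀ i → g i ∈ Λ (toℕ i) → sumOverWords n (λ x → χ z x * g i x) ≈ 0#
    orth i (k , v , a , v∈ , g≋) =
      orthogonal-combination (χ z) (g i) {a = a} {v = v} (λ j → orth′ j (v∈ j)) g≋
      where
      orth′ : ∀ j → ∃[ y ] weight y ≡ toℕ i × v j ≋ χ y → sumOverWords n (λ x → χ z x * v j x) ≈ 0#
      orth′ j (y , |y|≡i , v≋) = trans (sumOverWords-cong n λ x → *-congˡ (v≋ x))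
        (χ-orthogonal z y λ { ≡.refl → ℕ.<⇒≱ t<z (ℕ.≤-trans (ℕ.≤-reflexive |y|≡i) (Fin.toℕ≤pred[n] i)) })

  χ-encode : (b : Vector (Word n) d) (c : Word d) (x : Word n) →
             χ (encode b c) x ≈ χ c (syndrome b x)
  χ-encode b c x = reflexive (cong -1^_ (encode-∙ b c x))

  -- The indicator of the fibre is expanded in the characters `χ c` and the two sums are exchanged.
  -- The hypothesis annihilates every term except c = 0, so the result is independent of `s`.
  fibre-sum : (b : Vector (Word n) d) (s : Word d) (f : Point (Word n)) →
    (∀ c → c ≢ 𝟎 → sumOverWords n (λ x → χ (encode b c) x * f x) ≈ 0#) →
    ι (2 ^ d) * sumOverWords n (λ x → indicator (syndrome b x ≟ s) * f x) ≈ sumOverWords n f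
  fibre-sum {n = n} {d = d} b s f orth = begin
    ι (2 ^ d) * sumOverWords n (λ x → indicator (syndrome b x ≟ s) * f x)
      ≈⟨ sumOverWords-*ˡ n _ _ ⟨
    sumOverWords n (λ x → ι (2 ^ d) * (indicator (syndrome b x ≟ s) * f x))
      ≈⟨ sumOverWords-cong n (λ x → expand x) ⟩
    sumOverWords n (λ x → sumOverWords d (λ c → χ c s * (χ (encode b c) x * f x)))
      ≈⟨ sumOverWords-swap n d _ ⟩
    sumOverWords d (λ c → sumOverWords n (λ x → χ c s * (χ (encode b c) x * f x)))
      ≈⟨ sumOverWords-unique d (λ c c≢𝟎 → trans (sumOverWords-*ˡ n (χ c s) _)
           (trans (*-congˡ (orth c c≢𝟎)) (zeroʳ _))) ⟩
    sumOverWords n (λ x → χ 𝟎 s * (χ (encode b 𝟎) x * f x))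
      ≈⟨ sumOverWords-cong n (λ x → trans
           (*-cong (χ-𝟎 s) (trans (*-congʳ (χ-encode-𝟎 x)) (*-identityˡ (f x)))) (*-identityˡ (f x))) ⟩
    sumOverWords n f ∎
    where
    χ-encode-𝟎 : ∀ x → χ (encode b 𝟎) x ≈ 1#
    χ-encode-𝟎 x = trans (χ-encode b 𝟎 x) (χ-𝟎 (syndrome b x))

    expand : ∀ x → ι (2 ^ d) * (indicator (syndrome b x ≟ s) * f x) ≈
                   sumOverWords d (λ c → χ c s * (χ (encode b c) x * f x))
    expand x = begin
      ι (2 ^ d) * (indicator (syndrome b x ≟ s) * f x)
        ≈⟨ *-assoc _ _ _ ⟨
      ι (2 ^ d) * indicator (syndrome b x ≟ s) * f x
        ≈⟨ *-congʳ (χ-column-orthogonal s (syndrome b x)) ⟨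
      sumOverWords d (λ c → χ c s * χ c (syndrome b x)) * f x
        ≈⟨ *-comm _ _ ⟩
      f x * sumOverWords d (λ c → χ c s * χ c (syndrome b x))
        ≈⟨ sumOverWords-*ˡ d (f x) _ ⟨
      sumOverWords d (λ c → f x * (χ c s * χ c (syndrome b x)))
        ≈⟨ sumOverWords-cong d (λ c → trans (*-congˡ (*-congˡ (sym (χ-encode b c x))))
             (trans (*-comm _ _) (*-assoc _ _ _))) ⟩
      sumOverWords d (λ c → χ c s * (χ (encode b c) x * f x)) ∎

  -- Sizes of the syndrome fibres.

  module _ {S : Pred (Word n) ℓ} {b : Vector (Word n) d} (basis : IsBasis S b) where

    -- `fibre-sum` for the constant function 1 gives 2ᵈ m = 2ⁿ in the field. Its hypothesis holds
    -- because independence of the basis makes a nonzero `c` encode to a nonzero word, whose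
    -- character sums to 0.
    fibre-listing : ∀ s → Listing (λ x → syndrome b x ≟ s) (2 ^ (n ∸ d))
    fibre-listing s with m , L ← listing (λ x → syndrome b x ≟ s) =
      subst (Listing _) (2^d*m≡2^n⇒m≡2^[n∸d] d n m (ι-injective (2 ^ d ℕ.* m) (2 ^ n) count)) L
      where
      count : ι (2 ^ d ℕ.* m) ≈ ι (2 ^ n)
      count = begin
        ι (2 ^ d ℕ.* m)
          ≈⟨ ×1-homo-* (2 ^ d) m ⟩
        ι (2 ^ d) * ι m
          ≈⟨ *-congˡ (trans (sym (sum-replicate m)) (sum-word L (λ _ → 1#))) ⟩
        ι (2 ^ d) * sumOverWords n (λ x → indicator (syndrome b x ≟ s) * 1#)
          ≈⟨ fibre-sum b s (λ _ → 1#) (λ c c≢𝟎 →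
               trans (sumOverWords-cong n λ x → *-identityʳ _)
                     (sumOverWords-χ (encode b c) (encode-nonzero basis c c≢𝟎))) ⟩
        sumOverWords n (λ _ → 1#)
          ≈⟨ sumOverWords-1 n ⟩
        ι (2 ^ n) ∎

    -- By counting: each fibre has 2ⁿ⁻ᵈ > 0 elements.
    syndrome-surjective : ∀ s → ∃[ x ] syndrome b x ≡ s
    syndrome-surjective s =
      word L i , Equivalence.from (proj₂ (enumerates L) (word L i)) (i , ≡.refl)
      where
      L = fibre-listing s
      i = Fin.fromℕ< (ℕ.m^n>0 2 (n ∸ d))

  -- Fourier inversion: 2ᵈ a j = Σ_c χ_c(e j) Σ_i a i χ_c(e i), where e = word L.
  fourier-injective : ∀ {m} {P : Pred (Word d) ℓ} {P? : Decidable P} (L : Listing P? m)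
    (a : Vector Carrier m) → (∀ c → sum (λ i → a i * χ c (word L i)) ≈ 0#) → ∀ j → a j ≈ 0#
  fourier-injective {d = d} L a h j = *-cancelˡ-#0 (0<⇒#0 (0<ι2^ d)) (begin
    ι (2 ^ d) * a j
      ≈⟨ trans (*-comm _ _) (*-congˡ (sym (trans (*-congˡ (indicator-refl (e j ≟ e j))) (*-identityʳ _)))) ⟩
    a j * (ι (2 ^ d) * indicator (e j ≟ e j))
      ≈⟨ sum-unique j (λ i i≢j → trans (*-congˡ (trans (*-congˡ
           (indicator-no (e i ≟ e j) (i≢j ∘ proj₁ (enumerates L)))) (zeroʳ _))) (zeroʳ _)) ⟨
    sum (λ i → a i * (ι (2 ^ d) * indicator (e i ≟ e j)))
      ≈⟨ sum-cong-≋ (λ i → *-congˡ (χ-column-orthogonal (e j) (e i))) ⟨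
    sum (λ i → a i * sumOverWords d (λ c → χ c (e j) * χ c (e i)))
      ≈⟨ sum-cong-≋ (λ i → sumOverWords-*ˡ d (a i) _) ⟨
    sum (λ i → sumOverWords d (λ c → a i * (χ c (e j) * χ c (e i))))
      ≈⟨ sumOverWords-sum d (λ c i → a i * (χ c (e j) * χ c (e i))) ⟨
    sumOverWords d (λ c → sum (λ i → a i * (χ c (e j) * χ c (e i))))
      ≈⟨ sumOverWords-zero d (λ c → vanish c) ⟩
    0# ∎)
    where
    e = word L

    indicator-refl : ∀ {x : Word d} (p : Dec (x ≡ x)) → indicator p ≈ 1#
    indicator-refl (yes _)  = refl
    indicator-refl (no x≢x) = contradiction ≡.refl x≢x

    indicator-no : ∀ {x y : Word d} (p : Dec (x ≡ y)) → x ≢ y → indicator p ≈ 0#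
    indicator-no (yes x≡y) x≢y = contradiction x≡y x≢y
    indicator-no (no _)    _   = refl

    vanish : ∀ c → sum (λ i → a i * (χ c (e j) * χ c (e i))) ≈ 0#
    vanish c = begin
      sum (λ i → a i * (χ c (e j) * χ c (e i)))
        ≈⟨ sum-cong-≋ (λ i → x∙yz≈y∙xz (a i) (χ c (e j)) (χ c (e i))) ⟩
      sum (λ i → χ c (e j) * (a i * χ c (e i)))
        ≈⟨ *-distribˡ-sum (χ c (e j)) (λ i → a i * χ c (e i)) ⟨
      χ c (e j) * sum (λ i → a i * χ c (e i))
        ≈⟨ *-congˡ (h c) ⟩
      χ c (e j) * 0#
        ≈⟨ zeroʳ _ ⟩
      0# ∎

  -- The projected eigenconfiguration, its simplex and the design.

  module _ {t : ℕ} {S : Pred (Word n) ℓ} (code : IsLinearCode d (suc t) S) where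
    open IsLinearCode code
    open IsBasis (proj₂ dimension) using (members)

    private
      b = proj₁ dimension
      basis = proj₂ dimension

    πb : Word n → Point (NonzeroIn S)
    πb x = project code (eigenconfiguration n t x)

    fibre : Point (NonzeroIn S) → Pred (Word n) _
    fibre p x = πb x ≋ p

    encode-∈S : ∀ c → encode b c ∈ S
    encode-∈S = encode-∈ isSubspace b members

    codeword : ∀ c → c ≢ 𝟎 → NonzeroIn S
    codeword c c≢𝟎 = encode b c , [ encode-∈S c , encode-nonzero basis c c≢𝟎 ]

    -- Membership in S is irrelevant here, so the parities are recomputed.
    πb-cong : ∀ {x x′} → (∀ y → y ∈ S → y ∙ x ≡ y ∙ x′) → πb x ≋ πb x′
    πb-cong {x} {x′} eq (y , [ y∈S ]) =
      reflexive (cong -1^_ (recompute (y ∙ x ℙ.≟ y ∙ x′) (eq y (proj₁ y∈S))))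

    -- The choice of a word with syndrome `s` is immaterial up to `_≋_`, as `πb≋vertex` shows.
    vertex : Word d → Point (NonzeroIn S)
    vertex s = πb (proj₁ (syndrome-surjective basis s))

    πb≋vertex : ∀ x → πb x ≋ vertex (syndrome b x)
    πb≋vertex x = πb-cong
      (syndrome-≡⇒∙-≡ basis (≡.sym (proj₂ (syndrome-surjective basis (syndrome b x)))))

    -- Pulled back along `encode`, the coordinates of a vertex are the nontrivial characters of 𝔽₂ᵈ
    -- evaluated at its syndrome.
    vertex-coordinate : ∀ c (c≢𝟎 : c ≢ 𝟎) s →
      vertex s (codeword c c≢𝟎) ≈ χ c s
    vertex-coordinate c c≢𝟎 s =
      trans (χ-encode b c _) (reflexive (cong (χ c) (proj₂ (syndrome-surjective basis s))))

    -- The coordinates of the relation make every nontrivial Fourier coefficient of `a` vanish. The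
    -- trivial one, c = 0, is not a coordinate; it is supplied by Σ a = 0.
    vertices-affinelyIndependent : ∀ {m} {P : Pred (Word d) ℓ′} {P? : Decidable P}
                                   (L : Listing P? m) → AffinelyIndependent (vertex ∘ word L)
    vertices-affinelyIndependent L a Σa≈0 relation = fourier-injective L a χ-relation
      where
      χ-relation : ∀ c → sum (λ i → a i * χ c (word L i)) ≈ 0#
      χ-relation c with c ≟ 𝟎
      ... | yes ≡.refl =
        trans (sum-cong-≋ λ i → trans (*-congˡ (χ-𝟎 (word L i))) (*-identityʳ (a i))) Σa≈0
      ... | no c≢𝟎 =
        trans (sum-cong-≋ λ i → *-congˡ (sym (vertex-coordinate c c≢𝟎 (word L i))))
              (relation (codeword c c≢𝟎))

    -- Every syndrome is listed, so the chosen vertices exhaust the image of `πb`.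
    isSimplex : ∀ {k} → Listing {d} U? (suc k) →
                IsSimplex k (Image πb) (ConvexHull (Image πb))
    isSimplex L =
      vertex ∘ word L , vertices-affinelyIndependent L , (to , from) ,
      -- The same points and weights serve in either hull; only the membership of the points is
      -- translated.
      (λ (k , v , a , v∈ , rest) → k , v , a , to ∘ v∈ , rest) ,
      (λ (k , v , a , v∈ , rest) → k , v , a , from ∘ v∈ , rest)
      where
      to : ∀ {p} → p ∈ Image πb → p ∈ Image (vertex ∘ word L)
      to {p} (x , p≋) with i , eq ← Equivalence.to (proj₂ (enumerates L) (syndrome b x)) tt =
        i , λ y → trans (p≋ y) (trans (πb≋vertex x y) (reflexive (cong (λ s → vertex s y) (≡.sym eq))))
      from : ∀ {p} → p ∈ Image (vertex ∘ word L) → p ∈ Image πb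
      from (i , p≋) = _ , p≋

    -- All coordinates of `πb 𝟎` are 1, so lying over it means y · x = 0 for every nonzero y ∈ S.
    fibre≐Dual : fibre (πb 𝟎) ≐ Dual S
    fibre≐Dual = to , λ {x} x∈Dual → πb-cong λ y y∈S →
        ≡.trans (∙-comm y x) (≡.trans (x∈Dual y y∈S) (≡.sym (∙-zeroʳ y)))
      where
      to : ∀ {x} → x ∈ fibre (πb 𝟎) → x ∈ Dual S
      to {x} x∈ y y∈S with y ≟ 𝟎
      -- The zero word indexes no coordinate, but every `x` is orthogonal to it.
      ... | yes ≡.refl = ∙-zeroʳ x
      ... | no y≢𝟎 = ≡.trans (∙-comm x y)
        (≡.trans (-1^-injective (y ∙ x) (y ∙ 𝟎) (x∈ (y , [ y∈S , y≢𝟎 ]))) (∙-zeroʳ y))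

    private
      -- `syndrome b 𝟎` is the zero word; in this form the fibre compares with that of `πb 𝟎`
      -- through equality of syndromes.
      L : Listing (λ x → syndrome b x ≟ syndrome b 𝟎) (2 ^ (n ∸ d))
      L = fibre-listing basis (syndrome b 𝟎)

    fibre-enumerates : Enumerates (word L) (fibre (πb 𝟎))
    fibre-enumerates = proj₁ (enumerates L) , λ x → mk⇔
      (λ x∈ → Equivalence.to (proj₂ (enumerates L) x) (Vec.tabulate-cong λ i →
        ≡.trans (∙-comm (b i) x) (≡.trans (proj₁ fibre≐Dual x∈ (b i) (members i)) (≡.sym (∙-zeroʳ (b i))))))
      (λ i → πb-cong (syndrome-≡⇒∙-≡ basis (Equivalence.from (proj₂ (enumerates L) x) i)))

    -- Nonzero codewords have weight above `t`, so each test function is orthogonal to their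
    -- characters and `fibre-sum` applies.
    fibre-isDesign : IsUniformlyWeightedDesign t (fibre (πb 𝟎))
    fibre-isDesign = _ , word L , fibre-enumerates ,
      -- The weight 2ᵈ/2ⁿ is the reciprocal of the number of design points.
      1/2^ n * ι (2 ^ d) , *-pos (0<1/2^ n) (0<ι2^ d) , λ f f∈Λ≤ → begin
        1/2^ n * sumOverWords n f
          ≈⟨ *-congˡ (fibre-sum b (syndrome b 𝟎) f λ c c≢𝟎 → χ-orthogonal-Λ≤ (encode b c)
               (minDistance (encode-∈S c) (encode-nonzero basis c c≢𝟎)) f f∈Λ≤) ⟨
        1/2^ n * (ι (2 ^ d) * sumOverWords n (λ x → indicator (syndrome b x ≟ syndrome b 𝟎) * f x))
          ≈⟨ *-congˡ (*-congˡ (sum-word L f)) ⟨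
        1/2^ n * (ι (2 ^ d) * sum (f ∘ word L))
          ≈⟨ *-assoc _ _ _ ⟨
        1/2^ n * ι (2 ^ d) * sum (f ∘ word L) ∎

proposition4p10 : ∀ {c ℓ₁ ℓ₂ ℓ} (F : OrderedField c ℓ₁ ℓ₂) →
    let open OverOrderedField F in
    (n t d : ℕ) → 1 ≤ t → t ≤ n ∸ 1 →
    (S : Pred (Word n) ℓ) (code : IsLinearCode d (suc t) S) →
    let πb : Word n → Point (NonzeroIn S)
        πb x = project code (eigenconfiguration n t x)
        fibre : Point (NonzeroIn S) → Pred (Word n) _
        fibre p x = πb x ≋ p
    in
    IsSimplex (2 ^ d ∸ 1) (Image πb) (ConvexHull (Image πb)) ×
    (∃[ p ] p ∈ Image πb ×
            fibre p ≐ Dual S ×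
            IsUniformlyWeightedDesign t (fibre p) ×
            HasCardinality (fibre p) (2 ^ (n ∸ d)))
proposition4p10 F n t d _ _ S code =
  -- A k-simplex has k + 1 vertices, and 2ᵈ > 0 makes 1 + (2ᵈ ∸ 1) equal to 2ᵈ.
  isSimplex F code (subst (Listing F _) (≡.sym (ℕ.m+[n∸m]≡n (ℕ.m^n>0 2 d))) (allWords F d)) ,
  -- The vertex is the all-ones point, the image of the zero word: its fibre is the dual code
  -- itself, while the other fibres are cosets of it.
  πb F code 𝟎 , (𝟎 , λ _ → refl) , fibre≐Dual F code , fibre-isDesign F code ,
  _ , fibre-enumerates F code
  where open OrderedField F using (refl)
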